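{- Let $S$ be a finite nonempty ground set of size $n$, let $f,c:2^S\to\mathbb{R}_{\ge 0}$ and $\tau\le f(S)$ form an instance of Submodular Cost Submodular Cover (SCSC), and let $A^*$ be an optimal solution, i.e. $A^*$ minimizes $c(X)$ over all $X\subseteq S$ with $f(X)\ge\tau$. Let $\epsilon\ge 0$ and let $F:2^S\to\mathbb{R}_{\ge 0}$ be $\epsilon$-approximate to $f$. Suppose the greedy algorithm is run with input $F$, $c$, $\tau$ and returns the set $A$ (so that $F(A)\ge\tau$). Then $f(A)\ge\tau-\epsilon$. Moreover, if $\mu>4\epsilon c_{max}\rho/c_{min}$, then for any $\gamma\in\left(0,\,1-\frac{4\epsilon c_{max}\rho}{c_{min}\mu}\right)$, $$c(A)\le\frac{\rho}{1-\frac{4\epsilon c_{max}\rho}{c_{min}\mu}-\gamma}\left(\ln\left(\frac{n\alpha\rho}{\gamma\mu}\right)+2\right)c(A^*).$$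
   Context: SCSC instance: $f,c:2^S\to\mathbb{R}_{\ge0}$ are monotone ($g(X)\le g(Y)$ for $X\subseteq Y$) and submodular ($g(X\cup\{x\})-g(X)\ge g(Y\cup\{x\})-g(Y)$ for $X\subseteq Y\subseteq S$, $x\notin Y$), with $f(\emptyset)=0$, and $c(X)=0$ if and only if $X=\emptyset$; $\tau\le f(S)$ is a real threshold. The problem is to minimize $c(X)$ over $X\subseteq S$ with $f(X)\ge\tau$. $F$ is $\epsilon$-approximate to $f$ if $|f(X)-F(X)|\le\epsilon$ for all $X\subseteq S$. ($F$ is not assumed monotone or submodular.) Notation: $g_\tau(X)=\min\{\tau,g(X)\}$; $\Delta g(X,x)=g(X\cup\{x\})-g(X)$; $c(x)=c(\{x\})$. Greedy algorithm with input $F,c,\tau$: start with $A=\emptyset$; while $F(A)<\tau$, choose $u\in\text{argmax}_{x\in S\setminus A}\Delta F_\tau(A,x)/c(x)$ (ties broken arbitrarily) and replace $A$ by $A\cup\{u\}$; when $F(A)\ge\tau$, return $A$. Parameters: $c_{min}=\min_{x\in S}c(x)$, $c_{max}=\max_{x\in S}c(x)$, $\alpha=\max_{x\in S}f(\{x\})$, and $\rho=\max_{\emptyset\ne X\subseteq S}\sum_{x\in X}c(x)/c(X)$ is the curvature of $c$. If the run has $k$ iterations of the while loop, $A_0=\emptyset$ and $A_i$ is the set $A$ at the end of iteration $i$ (so $A=A_k$). Then $\mu=\min\{f_\tau(A_i)-f_\tau(A_{i-1}):i\in\{1,\dots,k\}\}$. If $k=0$, then $A=\emptyset$, $c(A)=0$,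 and the cost bound is regarded as holding trivially. -}

module Defs where

open import Level using (Level) renaming (suc to lsuc)
open import Algebra.Bundles using (CommutativeRing)
open import Algebra.Structures using (IsCommutativeRing)
open import Data.Bool.Base using (if_then_else_)
open import Data.Fin.Base using (Fin; zero; suc; toℕ; fromℕ; inject₁)
open import Data.Fin.Subset
  using (Subset; ⊥; ⊤; ⁅_⁆; _∈_; _∉_; _⊆_; _∪_; Nonempty)
open import Data.Nat.Base as ℕ using (ℕ; _!)
open import Data.Product.Base using (_×_; ∃; ∃-syntax)
open import Data.Vec.Base using (lookup)
open import Function.Bundles using (_⇔_)
open import Relation.Binary.Bundles using (DecTotalOrder)
open import Relation.Binary.Core using (Rel)
open import Relation.Binary.PropositionalEquality.Core using (_≡_)
open import Relation.Binary.Structures using (IsDecTotalOrder)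
open import Relation.Nullary.Negation.Core using (¬_)
open import Relation.Unary using (Pred; U)
import Algebra.Construct.NaturalChoice.Max as Max
import Algebra.Construct.NaturalChoice.Min as Min
import Algebra.Properties.Semiring.Exp as SemiringExp
import Algebra.Properties.Semiring.Mult as SemiringMult
import Algebra.Properties.Semiring.Sum as SemiringSum
import Relation.Binary.Properties.DecTotalOrder as DecTotalOrderProperties

-- The standard library has no real numbers, so ℝ is specified by the
-- textbook axioms, which determine it up to unique isomorphism: a
-- totally ordered field in which every nonempty set that is bounded
-- above has a least upper bound. The reading is the classical one: the
-- order is decidable, and _⁻¹ and sup are total functions of which
-- nothing is required at 0, respectively at sets that are empty or
-- unbounded above.

record Reals (ℓ : Level) : Set (lsuc ℓ) where
  infix  8 _⁻¹
  infix  8 -_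
  infixl 7 _*_
  infixl 6 _+_
  infix  4 _≈_ _≤_
  field
    Carrier : Set ℓ
    _≈_     : Rel Carrier ℓ
    _≤_     : Rel Carrier ℓ
    _+_ _*_ : Carrier → Carrier → Carrier
    -_ _⁻¹  : Carrier → Carrier
    0# 1#   : Carrier
    sup     : Pred Carrier ℓ → Carrier

  UpperBound : Pred Carrier ℓ → Pred Carrier ℓ
  UpperBound P b = ∀ x → P x → x ≤ b

  field
    isCommutativeRing : IsCommutativeRing _≈_ _+_ _*_ -_ 0# 1#
    isDecTotalOrder   : IsDecTotalOrder _≈_ _≤_
    0≉1               : ¬ (0# ≈ 1#)
    ⁻¹-cong           : ∀ {x y} → x ≈ y → x ⁻¹ ≈ y ⁻¹
    ⁻¹-inverseʳ       : ∀ x → ¬ (x ≈ 0#) → x * x ⁻¹ ≈ 1#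
    +-monoˡ-≤         : ∀ z {x y} → x ≤ y → x + z ≤ y + z
    *-nonneg          : ∀ {x y} → 0# ≤ x → 0# ≤ y → 0# ≤ x * y
    sup-upper         : ∀ P → ∃ P → ∃ (UpperBound P) → UpperBound P (sup P)
    sup-least         : ∀ P → ∃ P → ∃ (UpperBound P) →
                        ∀ b → UpperBound P b → sup P ≤ b

  commutativeRing : CommutativeRing ℓ ℓ
  commutativeRing = record { isCommutativeRing = isCommutativeRing }

  decTotalOrder : DecTotalOrder ℓ ℓ ℓ
  decTotalOrder = record { isDecTotalOrder = isDecTotalOrder }

  open CommutativeRing commutativeRing public using (_-_)
  open CommutativeRing commutativeRing using (semiring)
  open SemiringExp semiring public using (_^_)
  open SemiringMult semiring using () renaming (_×_ to _·_)
  open SemiringSum semiring public using (sum)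
  open DecTotalOrderProperties decTotalOrder public using (_<_)
  open Min (DecTotalOrder.totalOrder decTotalOrder) public using (_⊓_)
  open Max (DecTotalOrder.totalOrder decTotalOrder) public using (_⊔_)

  infixl 7 _/_
  _/_ : Carrier → Carrier → Carrier
  x / y = x * y ⁻¹

  ∣_∣ : Carrier → Carrier
  ∣ x ∣ = x ⊔ (- x)

  nat : ℕ → Carrier
  nat n = n · 1#

  -- The limit inferior of s, hence the limit of s if s converges.
  lim : (ℕ → Carrier) → Carrier
  lim s = sup λ a → ∃[ N ] (∀ n → N ℕ.≤ n → a ≤ s n)

  exp : Carrier → Carrier
  exp x = lim λ n → sum {n} λ i → x ^ toℕ i / nat (toℕ i !)

  -- As exp is an increasing bijection from ℝ onto the positive reals,
  -- for y > 0 this is the unique x with exp x = y. No meaning is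
  -- intended for y ≤ 0.
  ln : Carrier → Carrier
  ln y = sup λ x → exp x ≤ y

  -- m is the maximum (minimum) of g i over the indices i satisfying P.
  IsMax IsMin : ∀ {a p} {I : Set a} → Pred I p → (I → Carrier) →
                Carrier → Set _
  IsMax P g m = (∃[ i ] P i × g i ≈ m) × (∀ i → P i → g i ≤ m)
  IsMin P g m = (∃[ i ] P i × g i ≈ m) × (∀ i → P i → m ≤ g i)


module _ {ℓ} (ℝ : Reals ℓ) where
  open Reals ℝ

  SetFunction : ℕ → Set ℓ
  SetFunction n = Subset n → Carrier

  module _ {n : ℕ} where

    Nonnegative Monotone Submodular : SetFunction n → Set ℓ
    Nonnegative g = ∀ X → 0# ≤ g X
    Monotone g    = ∀ X Y → X ⊆ Y → g X ≤ g Y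

    Δ : SetFunction n → Subset n → Fin n → Carrier
    Δ g X x = g (X ∪ ⁅ x ⁆) - g X

    Submodular g = ∀ X Y x → X ⊆ Y → x ∉ Y → Δ g Y x ≤ Δ g X x

    truncate : Carrier → SetFunction n → SetFunction n
    truncate τ g X = τ ⊓ g X

    Approximates : Carrier → SetFunction n → SetFunction n → Set ℓ
    Approximates ε F f = ∀ X → ∣ f X - F X ∣ ≤ ε

    Σ[_]_ : Subset n → (Fin n → Carrier) → Carrier
    Σ[ X ] h = sum λ x → if lookup X x then h x else 0#

    IsCurvature : SetFunction n → Carrier → Set ℓ
    IsCurvature c = IsMax Nonempty λ X → (Σ[ X ] λ x → c ⁅ x ⁆) / c X

  record SCSC (n : ℕ) : Set ℓ where
    field
      f c           : SetFunction n
      τ             : Carrier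
      f-nonnegative : Nonnegative f
      f-monotone    : Monotone f
      f-submodular  : Submodular f
      f-empty       : f ⊥ ≈ 0#
      c-nonnegative : Nonnegative c
      c-monotone    : Monotone c
      c-submodular  : Submodular c
      c-zero        : ∀ X → (c X ≈ 0#) ⇔ (X ≡ ⊥)
      τ≤f[S]        : τ ≤ f ⊤

    Feasible : Pred (Subset n) ℓ
    Feasible X = τ ≤ f X

    Optimal : Pred (Subset n) ℓ
    Optimal X = Feasible X × (∀ Y → Feasible Y → c X ≤ c Y)

  module _ {n : ℕ} (F c : SetFunction n) (τ : Carrier) where

    -- u ∈ argmax_{x ∈ S∖A} ΔF_τ(A,x)/c(x)
    GreedyChoice : Subset n → Fin n → Set ℓ
    GreedyChoice A u = u ∉ A × (∀ x → x ∉ A → ratio x ≤ ratio u)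
      where
      ratio : Fin n → Carrier
      ratio x = Δ (truncate τ F) A x / c ⁅ x ⁆

    -- A terminating run of k iterations; A i is the set held after i of
    -- them. Ties may be broken in any way.
    record GreedyRun (k : ℕ) (A : Fin (ℕ.suc k) → Subset n) : Set ℓ where
      field
        start : A zero ≡ ⊥
        guard : ∀ (i : Fin k) → F (A (inject₁ i)) < τ
        step  : ∀ (i : Fin k) → ∃[ u ]
                GreedyChoice (A (inject₁ i)) u ×
                A (suc i) ≡ A (inject₁ i) ∪ ⁅ u ⁆
        stop  : τ ≤ F (A (fromℕ k))

  -- μ is the least increment f_τ(A_i) − f_τ(A_{i−1}), 1 ≤ i ≤ k; there
  -- is no such μ if k = 0.
  IsLeastIncrement : ∀ {n k} → SetFunction n → Carrier →
                     (Fin (ℕ.suc k) → Subset n) → Carrier → Set ℓ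
  IsLeastIncrement f τ A = IsMin U λ i →
    truncate τ f (A (suc i)) - truncate τ f (A (inject₁ i))

module Submission where

open import Defs
open import Algebra.Bundles using (CommutativeRing; RawRing)
open import Algebra.Solver.Ring.AlmostCommutativeRing
  using (fromCommutativeRing; _-Raw-AlmostCommutative⟶_)
open import Data.Bool.Base using (true; false; if_then_else_)
open import Data.Fin.Base using (Fin; zero; suc; toℕ; fromℕ; inject₁)
open import Data.Fin.Subset using (Subset; ⊥; ⊤; ⁅_⁆; _∈_; _∉_; _⊆_; _∪_; Nonempty)
open import Data.Fin.Subset.Properties
  using (∪-identityˡ; ∪-identityʳ; ∪-assoc; p⊆p∪q; q⊆p∪q; x∈p∪q⁻; x∈⁅x⁆; x∈⁅y⁆⇒x≡y; ∉⊥; ⊥⊆;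
         _∈?_; nonempty?; Empty-unique)
open import Data.Maybe.Base using (Maybe; just; nothing)
open import Data.Nat.Base as ℕ using (ℕ; zero; suc; NonZero; _!)
open import Data.Product.Base using (_×_; _,_; proj₁; proj₂; ∃; ∃-syntax; swap)
open import Data.Product.Properties using (≡-dec)
open import Data.Sum.Base using (_⊎_; inj₁; inj₂)
open import Data.Vec.Base using ([]; _∷_; lookup)
open import Function.Bundles using (Equivalence)
open import Relation.Binary.Bundles using (DecTotalOrder)
open import Relation.Binary.PropositionalEquality.Core as ≡ using (_≡_)
open import Relation.Nullary using (¬_; yes; no; contradiction)
open import Relation.Nullary.Decidable using (decidable-stable)
open import Relation.Unary using (U)
import Algebra.Construct.NaturalChoice.Max as Max
import Algebra.Construct.NaturalChoice.Min as Min
import Algebra.Properties.AbelianGroup as AbelianGroupProperties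
import Algebra.Properties.CommutativeSemigroup as CommutativeSemigroupProperties
import Algebra.Properties.Ring as RingProperties
import Algebra.Properties.Semiring.Mult as SemiringMult
import Algebra.Properties.Semiring.Sum as SemiringSum
import Algebra.Solver.Ring as RingSolver
import Data.Nat.Properties as ℕ
import Relation.Binary.Reasoning.Setoid as SetoidReasoning

-- Let rᵢ = τ - f_τ(Aᵢ) and K = c(A*)(ρ + κ). Comparing the greedy choice u
-- of iteration i + 1 with every element of A*, at an error of 2ε for each
-- marginal gain, and summing by submodularity gives
--   c(u) rᵢ ≤ ρ c(A*) (rᵢ - rᵢ₊₁ + 4ε cmax / cmin) ≤ K (rᵢ - rᵢ₊₁),
-- as rᵢ - rᵢ₊₁ ≥ μ. With y = Σ (rᵢ - rᵢ₊₁) / rᵢ over all iterations but the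
-- last, subadditivity of c yields c(A) ≤ K (y + 1), and exp y ≤ r₀ / μ follows
-- from exp t ≤ 1 / (1 - t). Finally r₀ ≤ τ ≤ nα and (ρ + κ)(1 - κ) ≤ ρ, since
-- ρ ≥ 1; the bound thus holds with room to spare, and γ only weakens it.

-- `exp` and `ln` are suprema, about which nothing is known until the underlying set is bounded. So
-- no limit is evaluated and no functional equation is proved: a bound on an exponential is carried
-- as a bound on all partial sums at once, and reaches `exp` and `ln` only at the end. The
-- inequality exp (x + y) (1 - y) ≤ exp x, valid for each partial sum by convexity of powers, does
-- double duty: it drives the iteration and, with y = 1/2, shows that the exponential series is
-- bounded at all. As `F` comes without submodularity, its marginal gains only serve to compare
-- elements at one and the same set; the summation over A* takes place in f_τ, which inherits
-- submodularity from f. Truncation is 1-Lipschitz, so a marginal gain errs by ε at each of its two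
-- sets. The errors at x and u get the weights c(u) and c(x), whose ratio is at most cmax / cmin,
-- and κ is chosen so that ρ times the resulting error is κμ, at most κ times any drop of r.

-- Ring identities with integer coefficients.

module RingIdentities {ℓ} (ℝ : Reals ℓ) where
  open Reals ℝ
  open CommutativeRing commutativeRing
    using (setoid; refl; sym; trans; reflexive; +-cong; +-congˡ; +-congʳ; *-cong; +-identityˡ;
           +-identityʳ; +-comm; distribˡ; distribʳ; -‿cong; -‿inverseʳ; ring; semiring;
           +-abelianGroup; +-commutativeSemigroup)
  open SemiringMult semiring using (×-homo-+; ×1-homo-*)

  -- Coefficients of ring identities are formal differences of naturals,
  -- reduced so that equal ones are identical.
  reduce : ℕ × ℕ → ℕ × ℕ
  reduce (m , n) = m ℕ.∸ n , n ℕ.∸ m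

  differences : RawRing _ _
  differences = record
    { Carrier = ℕ × ℕ
    ; _≈_     = _≡_
    ; _+_     = λ (a , b) (c , d) → reduce (a ℕ.+ c , b ℕ.+ d)
    ; _*_     = λ (a , b) (c , d) → reduce (a ℕ.* c ℕ.+ b ℕ.* d , a ℕ.* d ℕ.+ b ℕ.* c)
    ; -_      = swap
    ; 0#      = 0 , 0
    ; 1#      = 1 , 0
    }

  nat-+ : ∀ m n → nat (m ℕ.+ n) ≈ nat m + nat n
  nat-+ m n = ×-homo-+ 1# m n

  -- The special cases make con 0 and con 1 denote 0# and 1# on the nose.
  ⟦_⟧ : ℕ × ℕ → Carrier
  ⟦ 0 , 0 ⟧ = 0#
  ⟦ 1 , 0 ⟧ = 1#
  ⟦ m , n ⟧ = nat m - nat n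

  private
    open SetoidReasoning setoid
    open AbelianGroupProperties +-abelianGroup using (⁻¹-∙-comm; ⁻¹-involutive; ε⁻¹≈ε)
    open RingProperties ring using (-‿distribˡ-*; -‿distribʳ-*)
    open CommutativeSemigroupProperties +-commutativeSemigroup using (interchange)

    difference-+ : ∀ a b c d → (a + b) - (c + d) ≈ (a - c) + (b - d)
    difference-+ a b c d = begin
      (a + b) - (c + d)     ≈⟨ +-congˡ (⁻¹-∙-comm c d) ⟨
      (a + b) + (- c - d)   ≈⟨ interchange a b (- c) (- d) ⟩
      (a - c) + (b - d)     ∎

    difference-* : ∀ a b c d → (a * c + b * d) - (a * d + b * c) ≈ (a - b) * (c - d)
    difference-* a b c d = begin
      (a * c + b * d) - (a * d + b * c)         ≈⟨ difference-+ _ _ _ _ ⟩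
      (a * c - a * d) + (b * d - b * c)         ≈⟨ +-cong (+-congˡ (-‿distribʳ-* a d)) second ⟩
      (a * c + a * - d) + (- b * c + - b * - d) ≈⟨ +-cong (distribˡ a c (- d)) (distribˡ (- b) c (- d)) ⟨
      a * (c - d) + - b * (c - d)               ≈⟨ distribʳ (c - d) a (- b) ⟨
      (a - b) * (c - d)                         ∎
      where
      neg-* : b * d ≈ - b * - d
      neg-* = begin
        b * d         ≈⟨ ⁻¹-involutive _ ⟨
        - - (b * d)   ≈⟨ -‿cong (-‿distribˡ-* b d) ⟩
        - (- b * d)   ≈⟨ -‿distribʳ-* (- b) d ⟩
        - b * - d     ∎
      second : b * d - b * c ≈ - b * c + - b * - d
      second = trans (+-congˡ (-‿distribˡ-* b c)) (trans (+-comm _ _) (+-congˡ neg-*))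

    ⟦⟧-≈ : ∀ m n → ⟦ m , n ⟧ ≈ nat m - nat n
    ⟦⟧-≈ 0 0 = sym (-‿inverseʳ 0#)
    ⟦⟧-≈ 1 0 = sym (trans (+-cong (+-identityʳ 1#) ε⁻¹≈ε) (+-identityʳ 1#))
    ⟦⟧-≈ 0 (suc n) = refl
    ⟦⟧-≈ 1 (suc n) = refl
    ⟦⟧-≈ (suc (suc m)) n = refl

    -- Truncated subtraction strips one unit from both components at a time, and each stripped pair
    -- contributes 1 - 1.
    ⟦reduce⟧ : ∀ m n → ⟦ reduce (m , n) ⟧ ≈ nat m - nat n
    ⟦reduce⟧ zero    zero    = ⟦⟧-≈ 0 0
    ⟦reduce⟧ zero    (suc n) = refl
    ⟦reduce⟧ (suc m) zero    = ⟦⟧-≈ (suc m) 0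
    ⟦reduce⟧ (suc m) (suc n) = begin
      ⟦ reduce (m , n) ⟧              ≈⟨ ⟦reduce⟧ m n ⟩
      nat m - nat n                   ≈⟨ +-identityˡ _ ⟨
      0# + (nat m - nat n)            ≈⟨ +-congʳ (-‿inverseʳ 1#) ⟨
      (1# - 1#) + (nat m - nat n)     ≈⟨ difference-+ _ _ _ _ ⟨
      nat (suc m) - nat (suc n)       ∎

    morphism : differences -Raw-AlmostCommutative⟶ fromCommutativeRing commutativeRing
    morphism = record
      { ⟦_⟧    = ⟦_⟧
      ; +-homo = λ (a , b) (c , d) → begin
          ⟦ reduce (a ℕ.+ c , b ℕ.+ d) ⟧       ≈⟨ ⟦reduce⟧ (a ℕ.+ c) (b ℕ.+ d) ⟩
          nat (a ℕ.+ c) - nat (b ℕ.+ d)        ≈⟨ +-cong (nat-+ a c) (-‿cong (nat-+ b d)) ⟩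
          (nat a + nat c) - (nat b + nat d)    ≈⟨ difference-+ _ _ _ _ ⟩
          (nat a - nat b) + (nat c - nat d)    ≈⟨ +-cong (⟦⟧-≈ a b) (⟦⟧-≈ c d) ⟨
          ⟦ a , b ⟧ + ⟦ c , d ⟧                ∎
      ; *-homo = λ (a , b) (c , d) → begin
          ⟦ reduce (a ℕ.* c ℕ.+ b ℕ.* d , a ℕ.* d ℕ.+ b ℕ.* c) ⟧
            ≈⟨ ⟦reduce⟧ (a ℕ.* c ℕ.+ b ℕ.* d) (a ℕ.* d ℕ.+ b ℕ.* c) ⟩
          nat (a ℕ.* c ℕ.+ b ℕ.* d) - nat (a ℕ.* d ℕ.+ b ℕ.* c)
            ≈⟨ +-cong (nat-+* a c b d) (-‿cong (nat-+* a d b c)) ⟩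
          (nat a * nat c + nat b * nat d) - (nat a * nat d + nat b * nat c)
            ≈⟨ difference-* _ _ _ _ ⟩
          (nat a - nat b) * (nat c - nat d)
            ≈⟨ *-cong (⟦⟧-≈ a b) (⟦⟧-≈ c d) ⟨
          ⟦ a , b ⟧ * ⟦ c , d ⟧ ∎
      ; -‿homo = λ (a , b) → begin
          ⟦ b , a ⟧             ≈⟨ ⟦⟧-≈ b a ⟩
          nat b - nat a         ≈⟨ +-comm _ _ ⟩
          - nat a + nat b       ≈⟨ +-congˡ (⁻¹-involutive _) ⟨
          - nat a + - - nat b   ≈⟨ ⁻¹-∙-comm _ _ ⟩
          - (nat a - nat b)     ≈⟨ -‿cong (⟦⟧-≈ a b) ⟨
          - ⟦ a , b ⟧           ∎
      ; 0-homo = refl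
      ; 1-homo = refl
      }
      where
      nat-+* : ∀ a b c d → nat (a ℕ.* b ℕ.+ c ℕ.* d) ≈ nat a * nat b + nat c * nat d
      nat-+* a b c d = trans (nat-+ (a ℕ.* b) (c ℕ.* d)) (+-cong (×1-homo-* a b) (×1-homo-* c d))

    _≟_ : ∀ x y → Maybe (⟦ x ⟧ ≈ ⟦ y ⟧)
    x ≟ y with ≡-dec ℕ._≟_ ℕ._≟_ x y
    ... | yes x≡y = just (reflexive (≡.cong ⟦_⟧ x≡y))
    ... | no  _   = nothing

  open RingSolver differences (fromCommutativeRing commutativeRing) morphism _≟_ public
    using (solve; _:=_; _:+_; _:*_; _:-_; :-_; con; Polynomial)

  𝟎 𝟏 : ∀ {n} → Polynomial n
  𝟎 = con (0 , 0)
  𝟏 = con (1 , 0)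

-- Ordered field arithmetic and the Archimedean property.

module OrderedField {ℓ} (ℝ : Reals ℓ) where
  open Reals ℝ
  open RingIdentities ℝ
  open CommutativeRing commutativeRing
    using (refl; sym; trans; +-congˡ; +-congʳ; *-congˡ; *-congʳ; +-identityˡ; *-identityˡ;
           *-identityʳ; -‿cong)
  open DecTotalOrder decTotalOrder
    using (total; antisym)
    renaming (refl to ≤-refl; trans to ≤-trans; reflexive to ≤-reflexive)

  ≤-of-difference : ∀ {x y p} → 0# ≤ p → y - x ≈ p → x ≤ y
  ≤-of-difference {x} {y} {p} 0≤p y-x≈p = ≤-trans
    (≤-reflexive (sym (+-identityˡ x)))
    (≤-trans (+-monoˡ-≤ x 0≤p) (≤-reflexive
      (trans (+-congʳ (sym y-x≈p)) (solve 2 (λ x y → y :- x :+ x := y) refl x y))))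

  difference-nonneg : ∀ {x y} → x ≤ y → 0# ≤ y - x
  difference-nonneg {x} {y} x≤y = ≤-trans
    (≤-reflexive (solve 1 (λ x → 𝟎 := x :+ :- x) refl x)) (+-monoˡ-≤ (- x) x≤y)

  +-mono-≤ : ∀ {x y u v} → x ≤ y → u ≤ v → x + u ≤ y + v
  +-mono-≤ {x} {y} {u} {v} x≤y u≤v = ≤-trans (+-monoˡ-≤ u x≤y) (≤-trans
    (≤-reflexive (solve 2 (λ y u → y :+ u := u :+ y) refl y u)) (≤-trans (+-monoˡ-≤ y u≤v)
    (≤-reflexive (solve 2 (λ y u → u :+ y := y :+ u) refl y v))))

  +-nonneg : ∀ {x y} → 0# ≤ x → 0# ≤ y → 0# ≤ x + y
  +-nonneg 0≤x 0≤y = ≤-trans (≤-reflexive (sym (+-identityˡ 0#))) (+-mono-≤ 0≤x 0≤y)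

  ≤-difference⇒≤ : ∀ {x y z} → 0# ≤ y → z ≤ x - y → z ≤ x
  ≤-difference⇒≤ {x} {y} {z} 0≤y z≤x-y = ≤-of-difference (+-nonneg (difference-nonneg z≤x-y) 0≤y)
    (solve 3 (λ x y z → x :- z := x :- y :- z :+ y) refl x y z)

  *-monoˡ-≤ : ∀ {z x y} → 0# ≤ z → x ≤ y → x * z ≤ y * z
  *-monoˡ-≤ {z} {x} {y} 0≤z x≤y = ≤-of-difference (*-nonneg (difference-nonneg x≤y) 0≤z)
    (solve 3 (λ x y z → y :* z :- x :* z := (y :- x) :* z) refl x y z)

  *-monoʳ-≤ : ∀ {z x y} → 0# ≤ z → x ≤ y → z * x ≤ z * y
  *-monoʳ-≤ {z} {x} {y} 0≤z x≤y = ≤-of-difference (*-nonneg 0≤z (difference-nonneg x≤y))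
    (solve 3 (λ x y z → z :* y :- z :* x := z :* (y :- x)) refl x y z)

  *-mono-≤ : ∀ {x y u v} → 0# ≤ y → 0# ≤ u → x ≤ y → u ≤ v → x * u ≤ y * v
  *-mono-≤ 0≤y 0≤u x≤y u≤v = ≤-trans (*-monoˡ-≤ 0≤u x≤y) (*-monoʳ-≤ 0≤y u≤v)

  <⇒≤ : ∀ {x y} → x < y → x ≤ y
  <⇒≤ = proj₁

  <⇒≱ : ∀ {x y} → x < y → ¬ (y ≤ x)
  <⇒≱ (x≤y , x≉y) y≤x = x≉y (antisym x≤y y≤x)

  ≰⇒≥ : ∀ {x y} → ¬ (x ≤ y) → y ≤ x
  ≰⇒≥ {x} {y} x≰y with total x y
  ... | inj₁ x≤y = contradiction x≤y x≰y
  ... | inj₂ y≤x = y≤x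

  ≰⇒> : ∀ {x y} → ¬ (x ≤ y) → y < x
  ≰⇒> x≰y = ≰⇒≥ x≰y , λ y≈x → x≰y (≤-reflexive (sym y≈x))

  <-≤-trans : ∀ {x y z} → x < y → y ≤ z → x < z
  <-≤-trans x<y y≤z = ≤-trans (<⇒≤ x<y) y≤z ,
    λ x≈z → <⇒≱ x<y (≤-trans y≤z (≤-reflexive (sym x≈z)))

  ≤-<-trans : ∀ {x y z} → x ≤ y → y < z → x < z
  ≤-<-trans x≤y y<z = ≤-trans x≤y (<⇒≤ y<z) ,
    λ x≈z → <⇒≱ y<z (≤-trans (≤-reflexive (sym x≈z)) x≤y)

  pos⇒≉0 : ∀ {x} → 0# < x → ¬ (x ≈ 0#)
  pos⇒≉0 0<x x≈0 = proj₂ 0<x (sym x≈0)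

  *-inverse : ∀ {x} → 0# < x → x * x ⁻¹ ≈ 1#
  *-inverse {x} 0<x = ⁻¹-inverseʳ x (pos⇒≉0 0<x)

  0≤square : ∀ x → 0# ≤ x * x
  0≤square x with total 0# x
  ... | inj₁ 0≤x = *-nonneg 0≤x 0≤x
  ... | inj₂ x≤0 = ≤-of-difference (*-nonneg (difference-nonneg x≤0) (difference-nonneg x≤0))
    (solve 1 (λ x → x :* x :- 𝟎 := (𝟎 :- x) :* (𝟎 :- x)) refl x)

  0<1 : 0# < 1#
  0<1 = ≤-trans (0≤square 1#) (≤-reflexive (*-identityˡ 1#)) , 0≉1

  -- The inverse equals x times its own square.
  ⁻¹-nonneg : ∀ {x} → 0# < x → 0# ≤ x ⁻¹
  ⁻¹-nonneg {x} 0<x = ≤-trans (*-nonneg (<⇒≤ 0<x) (0≤square (x ⁻¹)))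
    (≤-reflexive (trans (solve 2 (λ x y → x :* (y :* y) := (x :* y) :* y) refl x (x ⁻¹))
      (trans (*-congʳ (*-inverse 0<x)) (*-identityˡ _))))

  /-cancel : ∀ {y} x → 0# < y → x / y * y ≈ x
  /-cancel {y} x 0<y = trans (solve 3 (λ x y z → x :* z :* y := x :* (y :* z)) refl x y (y ⁻¹))
    (trans (*-congˡ (*-inverse 0<y)) (*-identityʳ x))

  *-/-cancel : ∀ {y} x → 0# < y → x * y / y ≈ x
  *-/-cancel {y} x 0<y = trans (solve 3 (λ x y z → x :* y :* z := x :* z :* y) refl x y (y ⁻¹))
    (/-cancel x 0<y)

  *≤⇒≤/ : ∀ {x y z} → 0# < z → x * z ≤ y → x ≤ y / z
  *≤⇒≤/ {x} 0<z xz≤y = ≤-trans (≤-reflexive (sym (*-/-cancel x 0<z))) (*-monoˡ-≤ (⁻¹-nonneg 0<z) xz≤y)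

  ≤*⇒/≤ : ∀ {x y z} → 0# < z → x ≤ y * z → x / z ≤ y
  ≤*⇒/≤ {y = y} 0<z x≤yz = ≤-trans (*-monoˡ-≤ (⁻¹-nonneg 0<z) x≤yz) (≤-reflexive (*-/-cancel y 0<z))

  /≤⇒≤* : ∀ {x y z} → 0# < z → x / z ≤ y → x ≤ y * z
  /≤⇒≤* {x} 0<z x/z≤y = ≤-trans (≤-reflexive (sym (/-cancel x 0<z))) (*-monoˡ-≤ (<⇒≤ 0<z) x/z≤y)

  /-cross : ∀ {x y u v} → 0# < y → 0# < v → x / y ≤ u / v → x * v ≤ u * y
  /-cross {x} {y} {u} {v} 0<y 0<v le = ≤-trans
    (*-monoˡ-≤ (<⇒≤ 0<v) (/≤⇒≤* 0<y le))
    (≤-trans (≤-reflexive (solve 3 (λ p y v → p :* y :* v := p :* v :* y) refl (u / v) y v))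
      (≤-reflexive (*-congʳ (/-cancel u 0<v))))

  /-nonneg : ∀ {x y} → 0# ≤ x → 0# < y → 0# ≤ x / y
  /-nonneg 0≤x 0<y = *-nonneg 0≤x (⁻¹-nonneg 0<y)

  *-cancelʳ-≤ : ∀ {x y z} → 0# < z → x * z ≤ y * z → x ≤ y
  *-cancelʳ-≤ {y = y} 0<z xz≤yz = ≤-trans (*≤⇒≤/ 0<z xz≤yz) (≤-reflexive (*-/-cancel y 0<z))

  *-pos : ∀ {x y} → 0# < x → 0# < y → 0# < x * y
  *-pos {x} {y} 0<x 0<y = *-nonneg (<⇒≤ 0<x) (<⇒≤ 0<y) , λ 0≈xy → pos⇒≉0 0<x
    (trans (sym (*-/-cancel x 0<y)) (trans (*-congʳ (sym 0≈xy)) (solve 1 (λ z → 𝟎 :* z := 𝟎) refl (y ⁻¹))))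

  nat-nonneg : ∀ n → 0# ≤ nat n
  nat-nonneg zero    = ≤-refl
  nat-nonneg (suc n) = +-nonneg (<⇒≤ 0<1) (nat-nonneg n)

  nat-pos : ∀ n → 0# < nat (suc n)
  nat-pos n = <-≤-trans 0<1 (≤-of-difference (nat-nonneg n)
    (solve 1 (λ x → 𝟏 :+ x :- 𝟏 := x) refl (nat n)))

  -- If the multiples of h had a supremum s, then s - h would bound them too, because the successor
  -- of each multiple is still at most s.
  archimedean : ∀ {h} → 0# < h → ∀ x → ¬ (∀ m → nat m * h ≤ x)
  archimedean {h} 0<h x bounded = <⇒≱ s-h<s s≤s-h
    where
    Multiple : Carrier → Set _
    Multiple y = ∃[ m ] y ≈ nat m * h
    s = sup Multiple
    inhabited : ∃ Multiple
    inhabited = nat 0 * h , 0 , refl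
    above : ∃ (UpperBound Multiple)
    above = x , λ y (m , y≈mh) → ≤-trans (≤-reflexive y≈mh) (bounded m)
    s≤s-h : s ≤ s - h
    s≤s-h = sup-least Multiple inhabited above (s - h) λ y (m , y≈mh) →
      ≤-of-difference
        (difference-nonneg (sup-upper Multiple inhabited above (nat (suc m) * h) (suc m , refl)))
        (trans (+-congˡ (-‿cong y≈mh))
          (solve 3 (λ s h m → s :- h :- m :* h := s :- (𝟏 :+ m) :* h) refl s h (nat m)))
    s-h<s : s - h < s
    s-h<s = ≰⇒> λ s≤s-h → <⇒≱ 0<h (≤-of-difference (difference-nonneg s≤s-h)
      (solve 2 (λ s h → 𝟎 :- h := s :- h :- s) refl s h))

-- Partial sums of the exponential series, logarithm, and the recursion for the cost.

module Exponential {ℓ} (ℝ : Reals ℓ) where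
  open Reals ℝ
  open RingIdentities ℝ
  open OrderedField ℝ
  open CommutativeRing commutativeRing
    using (setoid; refl; sym; trans; +-cong; +-congˡ; +-congʳ; +-assoc; *-congˡ; -‿cong;
           +-identityˡ; semiring)
  open DecTotalOrder decTotalOrder
    using (_≤?_; total)
    renaming (refl to ≤-refl; trans to ≤-trans; reflexive to ≤-reflexive)
  open SemiringMult semiring using (×1-homo-*)

  sum-nonneg : ∀ {n} (s : Fin n → Carrier) → (∀ i → 0# ≤ s i) → 0# ≤ sum s
  sum-nonneg {zero}  s 0≤s = ≤-refl
  sum-nonneg {suc n} s 0≤s = +-nonneg (0≤s zero) (sum-nonneg (λ i → s (suc i)) (λ i → 0≤s (suc i)))

  sum-mono-≤ : ∀ {n} (s t : Fin n → Carrier) → (∀ i → s i ≤ t i) → sum s ≤ sum t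
  sum-mono-≤ {zero}  s t s≤t = ≤-refl
  sum-mono-≤ {suc n} s t s≤t =
    +-mono-≤ (s≤t zero) (sum-mono-≤ (λ i → s (suc i)) (λ i → t (suc i)) (λ i → s≤t (suc i)))

  sum-initial-≤ : ∀ n (s : ℕ → Carrier) → (∀ i → 0# ≤ s i) →
                  sum {n} (λ i → s (toℕ i)) ≤ sum {suc n} (λ i → s (toℕ i))
  sum-initial-≤ zero    s 0≤s = sum-nonneg {1} (λ i → s (toℕ i)) (λ i → 0≤s (toℕ i))
  sum-initial-≤ (suc n) s 0≤s = +-mono-≤ ≤-refl (sum-initial-≤ n (λ i → s (suc i)) (λ i → 0≤s (suc i)))

  ^-nonneg : ∀ {x} → 0# ≤ x → ∀ n → 0# ≤ x ^ n
  ^-nonneg 0≤x zero    = <⇒≤ 0<1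
  ^-nonneg 0≤x (suc n) = *-nonneg 0≤x (^-nonneg 0≤x n)

  ^-mono-≤ : ∀ {x y} → 0# ≤ x → x ≤ y → ∀ n → x ^ n ≤ y ^ n
  ^-mono-≤ 0≤x x≤y zero    = ≤-refl
  ^-mono-≤ 0≤x x≤y (suc n) = *-mono-≤ (≤-trans 0≤x x≤y) (^-nonneg 0≤x n) x≤y (^-mono-≤ 0≤x x≤y n)

  -- Convexity: the power lies above its tangent at y, evaluated at x. In the inductive step the
  -- slack is y times the previous slack plus (y - x) times the difference of the lower powers.
  ^-tangent-≤ : ∀ {x y} → 0# ≤ x → x ≤ y → ∀ n →
                y ^ suc n ≤ x ^ suc n + (y - x) * (nat (suc n) * y ^ n)
  ^-tangent-≤ {x} {y} 0≤x x≤y zero = ≤-reflexive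
    (solve 2 (λ x y → y :* 𝟏 := x :* 𝟏 :+ (y :- x) :* ((𝟏 :+ 𝟎) :* 𝟏)) refl x y)
  ^-tangent-≤ {x} {y} 0≤x x≤y (suc n) = ≤-of-difference
    (+-nonneg (*-nonneg (≤-trans 0≤x x≤y) (difference-nonneg (^-tangent-≤ 0≤x x≤y n)))
      (*-nonneg (difference-nonneg x≤y) (difference-nonneg (^-mono-≤ 0≤x x≤y (suc n)))))
    (solve 5 (λ x y p q m →
        (x :* (x :* p)) :+ (y :- x) :* ((𝟏 :+ (𝟏 :+ m)) :* (y :* q)) :- y :* (y :* q)
      := y :* ((x :* p) :+ (y :- x) :* ((𝟏 :+ m) :* q) :- y :* q) :+ (y :- x) :* (y :* q :- x :* p))
      refl x y (x ^ n) (y ^ n) (nat n))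

  term : Carrier → ℕ → Carrier
  term x i = x ^ i / nat (i !)

  expₙ : ℕ → Carrier → Carrier
  expₙ n x = sum {n} λ i → term x (toℕ i)

  nat-!-pos : ∀ n → 0# < nat (n !)
  nat-!-pos zero    = nat-pos 0
  nat-!-pos (suc n) = ≤-trans (<⇒≤ pos) (≤-reflexive (sym eq)) , λ 0≈ → proj₂ pos (trans 0≈ eq)
    where
    pos = *-pos (nat-pos n) (nat-!-pos n)
    eq = ×1-homo-* (suc n) (n !)

  term-nonneg : ∀ {x} → 0# ≤ x → ∀ n → 0# ≤ term x n
  term-nonneg 0≤x n = /-nonneg (^-nonneg 0≤x n) (nat-!-pos n)

  expₙ-nonneg : ∀ {x} → 0# ≤ x → ∀ n → 0# ≤ expₙ n x
  expₙ-nonneg 0≤x n = sum-nonneg {n} _ (λ i → term-nonneg 0≤x (toℕ i))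

  expₙ-mono-≤ : ∀ {x y} → 0# ≤ x → x ≤ y → ∀ n → expₙ n x ≤ expₙ n y
  expₙ-mono-≤ 0≤x x≤y n = sum-mono-≤ {n} _ _ λ i →
    *-monoˡ-≤ (⁻¹-nonneg (nat-!-pos (toℕ i))) (^-mono-≤ 0≤x x≤y (toℕ i))

  -- The derivative of each term is the preceding term: the factorial absorbs the factor
  -- `nat (suc n)`.
  term-tangent-≤ : ∀ {x y} → 0# ≤ x → x ≤ y → ∀ n →
                   term y (suc n) ≤ term x (suc n) + (y - x) * term y n
  term-tangent-≤ {x} {y} 0≤x x≤y n = ≤*⇒/≤ (nat-!-pos (suc n)) (≤-trans (^-tangent-≤ 0≤x x≤y n)
    (≤-reflexive (sym (begin
      (X + (y - x) * t) * d             ≈⟨ solve 5 (λ x y X t d → (X :+ (y :- x) :* t) :* d := X :* d :+ (y :- x) :* (t :* d)) refl x y X t d ⟩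
      X * d + (y - x) * (t * d)         ≈⟨ +-cong (/-cancel (x ^ suc n) (nat-!-pos (suc n))) (*-congˡ (*-congˡ (×1-homo-* (suc n) (n !)))) ⟩
      x ^ suc n + (y - x) * (t * (nat (suc n) * nat (n !)))
                                        ≈⟨ +-congˡ (*-congˡ (solve 3 (λ t m f → t :* (m :* f) := m :* (t :* f)) refl t (nat (suc n)) (nat (n !)))) ⟩
      x ^ suc n + (y - x) * (nat (suc n) * (t * nat (n !)))
                                        ≈⟨ +-congˡ (*-congˡ (*-congˡ (/-cancel (y ^ n) (nat-!-pos n)))) ⟩
      x ^ suc n + (y - x) * (nat (suc n) * y ^ n) ∎))))
    where
    open SetoidReasoning setoid
    X = term x (suc n)
    t = term y n
    d = nat (suc n !)

  sum-affine-≤ : ∀ {n} w (r s t : Fin n → Carrier) → (∀ i → r i ≤ s i + w * t i) →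
                 sum r ≤ sum s + w * sum t
  sum-affine-≤ {zero}  w r s t r≤ = ≤-reflexive (solve 1 (λ w → 𝟎 := 𝟎 :+ w :* 𝟎) refl w)
  sum-affine-≤ {suc n} w r s t r≤ = ≤-trans
    (+-mono-≤ (r≤ zero) (sum-affine-≤ w (λ i → r (suc i)) (λ i → s (suc i)) (λ i → t (suc i)) (λ i → r≤ (suc i))))
    (≤-reflexive (solve 5 (λ w a b c d → (a :+ w :* b) :+ (c :+ w :* d) := (a :+ c) :+ w :* (b :+ d))
      refl w (s zero) (t zero) (sum λ i → s (suc i)) (sum λ i → t (suc i))))

  -- The constant term does not change, and the others produce the sum at y without its last term.
  -- That term is nonnegative, so it may be added to make the same `expₙ n y` appear on both sides.
  expₙ-tangent-≤ : ∀ {x y} → 0# ≤ x → x ≤ y → ∀ n → expₙ n y ≤ expₙ n x + (y - x) * expₙ n y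
  expₙ-tangent-≤ {x} {y} 0≤x x≤y zero = ≤-reflexive
    (solve 2 (λ x y → 𝟎 := 𝟎 :+ (y :- x) :* 𝟎) refl x y)
  expₙ-tangent-≤ {x} {y} 0≤x x≤y (suc n) = ≤-trans
    (+-mono-≤ ≤-refl (sum-affine-≤ {n} (y - x) _ _ _ λ i → term-tangent-≤ 0≤x x≤y (toℕ i)))
    (≤-trans (≤-reflexive (sym (+-assoc _ _ _)))
      (+-mono-≤ ≤-refl (*-monoʳ-≤ (difference-nonneg x≤y)
        (sum-initial-≤ n (term y) (term-nonneg (≤-trans 0≤x x≤y))))))

  -- The elementary form of exp y ≤ 1 / (1 - y).
  expₙ-+-≤ : ∀ {x y} → 0# ≤ x → 0# ≤ y → ∀ n → expₙ n (x + y) * (1# - y) ≤ expₙ n x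
  expₙ-+-≤ {x} {y} 0≤x 0≤y n = ≤-of-difference
    (difference-nonneg (expₙ-tangent-≤ 0≤x (≤-of-difference 0≤y
      (solve 2 (λ x y → x :+ y :- x := y) refl x y)) n))
    (solve 4 (λ x y p q → p :- q :* (𝟏 :- y) := p :+ (x :+ y :- x) :* q :- q) refl x y (expₙ n x) (expₙ n (x + y)))

  -- Uniformity in the number of terms is what licenses the use of the supremum behind `exp`.
  ExpBound : Carrier → Carrier → Set ℓ
  ExpBound x b = ∀ n → expₙ n x ≤ b

  private
    half : Carrier
    half = 1# / nat 2

    0<half : 0# < half
    0<half = ≰⇒> λ half≤0 → <⇒≱ 0<1
      (≤-trans (/≤⇒≤* (nat-pos 1) half≤0) (≤-reflexive (solve 1 (λ x → 𝟎 :* x := 𝟎) refl (nat 2))))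

    half-complement : 1# - half ≈ half
    half-complement = trans
      (+-congʳ (sym (/-cancel 1# (nat-pos 1))))
      (solve 1 (λ h → h :* (𝟏 :+ (𝟏 :+ 𝟎)) :- h := h) refl half)

    multiple-nonneg : ∀ m → 0# ≤ nat m * half
    multiple-nonneg m = *-nonneg (nat-nonneg m) (<⇒≤ 0<half)

  sum-nonpos : ∀ {n} (s : Fin n → Carrier) → (∀ i → s i ≤ 0#) → sum s ≤ 0#
  sum-nonpos {zero}  s s≤0 = ≤-refl
  sum-nonpos {suc n} s s≤0 = ≤-trans
    (+-mono-≤ (s≤0 zero) (sum-nonpos (λ i → s (suc i)) (λ i → s≤0 (suc i))))
    (≤-reflexive (+-identityˡ 0#))

  expₙ-0 : ExpBound 0# 1#
  expₙ-0 zero    = <⇒≤ 0<1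
  expₙ-0 (suc n) = ≤-trans
    (+-mono-≤ (≤*⇒/≤ (nat-pos 0) (≤-reflexive (solve 0 (𝟏 := 𝟏 :* (𝟏 :+ 𝟎)) refl)))
      (sum-nonpos {n} (λ i → term 0# (suc (toℕ i))) λ i → ≤-reflexive
        (solve 2 (λ p q → 𝟎 :* p :* q := 𝟎) refl (0# ^ toℕ i) (nat (suc (toℕ i) !) ⁻¹))))
    (≤-reflexive (solve 0 (𝟏 :+ 𝟎 := 𝟏) refl))

  -- By `expₙ-+-≤` with y = `half`, where 1 - y is positive, each further step at most doubles the
  -- bound.
  multiple-bounded : ∀ m → ∃ (ExpBound (nat m * half))
  multiple-bounded zero = 1# , λ n → ≤-trans
    (expₙ-mono-≤ (multiple-nonneg 0) (≤-reflexive (solve 1 (λ h → 𝟎 :* h := 𝟎) refl half)) n) (expₙ-0 n)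
  multiple-bounded (suc m) = let b , bound = multiple-bounded m in b / half , λ n → *≤⇒≤/ 0<half
    (≤-trans
      (*-monoˡ-≤ (<⇒≤ 0<half) (expₙ-mono-≤ (multiple-nonneg (suc m))
        (≤-reflexive (solve 2 (λ m h → (𝟏 :+ m) :* h := m :* h :+ h) refl (nat m) half)) n))
      (≤-trans (≤-reflexive (*-congˡ (sym half-complement)))
        (≤-trans (expₙ-+-≤ (multiple-nonneg m) (<⇒≤ 0<half) n) (bound n))))

  -- An eventual lower bound of the partial sums lies below one of them, hence below y. The number 0
  -- shows that such lower bounds exist.
  exp-≤ : ∀ {x y} → 0# ≤ x → ExpBound x y → exp x ≤ y
  exp-≤ {x} {y} 0≤x bound = sup-least _ (0# , 0 , λ n _ → expₙ-nonneg 0≤x n)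
    (y , below) y below
    where
    below : ∀ a → ∃[ N ] (∀ n → N ℕ.≤ n → a ≤ expₙ n x) → a ≤ y
    below a (N , a≤) = ≤-trans (a≤ N ℕ.≤-refl) (bound N)

  -- The linear term alone is x, so two terms suffice.
  x≤expₙ : ∀ {x} → 0# ≤ x → ∀ n → x ≤ expₙ (2 ℕ.+ n) x
  x≤expₙ {x} 0≤x n = ≤-of-difference
    (+-nonneg (term-nonneg 0≤x 0) (+-nonneg (difference-nonneg (*≤⇒≤/ (nat-pos 0) (≤-reflexive
        (solve 1 (λ x → x :* (𝟏 :+ 𝟎) := x :* 𝟏) refl x))))
      (sum-nonneg {n} (λ i → term x (2 ℕ.+ toℕ i)) (λ i → term-nonneg 0≤x (2 ℕ.+ toℕ i)))))
    (solve 4 (λ x p q r → p :+ (q :+ r) :- x := p :+ ((q :- x) :+ r)) refl x (term x 0) (term x 1)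
      (sum {n} λ i → term x (2 ℕ.+ toℕ i)))

  x≤exp : ∀ {x b} → 0# ≤ x → ExpBound x b → x ≤ exp x
  x≤exp {x} {b} 0≤x bound = sup-upper _ (x , member)
    (b , λ a (N , a≤) → ≤-trans (a≤ N ℕ.≤-refl) (bound N)) x member
    where
    member : ∃[ N ] (∀ n → N ℕ.≤ n → x ≤ expₙ n x)
    member = 2 , λ { _ (ℕ.s≤s (ℕ.s≤s {n = n} _)) → x≤expₙ 0≤x n }

  -- exp x is known to be meaningful only below some multiple of half; such
  -- a multiple is found by contradiction, as the order is decidable.
  exp≤⇒≤ : ∀ {x y} → 0# ≤ y → exp x ≤ y → x ≤ y
  exp≤⇒≤ {x} {y} 0≤y exp≤y with total x 0#
  ... | inj₁ x≤0 = ≤-trans x≤0 0≤y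
  ... | inj₂ 0≤x = decidable-stable (x ≤? y) λ x≰y → archimedean 0<half x λ m →
    ≰⇒≥ λ x≤mh → let b , bound = multiple-bounded m in
      x≰y (≤-trans (x≤exp 0≤x (λ n → ≤-trans (expₙ-mono-≤ 0≤x x≤mh n) (bound n))) exp≤y)

  -- By `exp≤⇒≤`, y itself bounds the set whose supremum is `ln y`. The empty partial sum in
  -- `bound 0` yields 0 ≤ y.
  ≤-ln : ∀ {x y} → 0# ≤ x → ExpBound x y → x ≤ ln y
  ≤-ln {x} {y} 0≤x bound = sup-upper _ (x , exp≤y) (y , λ _ → exp≤⇒≤ (bound 0)) x exp≤y
    where
    exp≤y : exp x ≤ y
    exp≤y = exp-≤ 0≤x bound

  -- The witness y is x plus the relative decreases (rᵢ − rᵢ₊₁) / rᵢ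
  -- over all steps but the last, in which r may drop to 0.
  logarithmic-cost : ∀ {K μ R x} → 0# ≤ K → 0# < μ →
    ∀ k (a r : Fin (2 ℕ.+ k) → Carrier) →
    (∀ i → 0# ≤ r i) →
    (∀ i → μ ≤ r (inject₁ i) - r (suc i)) →
    (∀ i → (a (suc i) - a (inject₁ i)) * r (inject₁ i) ≤ K * (r (inject₁ i) - r (suc i))) →
    0# ≤ x → a zero ≤ K * x → (∀ n → expₙ n x * r zero ≤ R) →
    ∃[ y ] 0# ≤ y × a (fromℕ (suc k)) ≤ K * (y + 1#) × (∀ n → expₙ n y * μ ≤ R)
  logarithmic-cost {K} {μ} {R} {x} 0≤K 0<μ zero a r 0≤r drop charge 0≤x a≤ bound =
    x , 0≤x , a₁≤ , λ n → ≤-trans (*-monoʳ-≤ (expₙ-nonneg 0≤x n) μ≤r₀) (bound n)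
    where
    a₀ = a zero
    a₁ = a (suc zero)
    r₀ = r zero
    r₁ = r (suc zero)
    -- The last drop bounds r₀ from below, so the bound on `expₙ n x * r zero` persists with μ in
    -- place of `r zero`.
    μ≤r₀ : μ ≤ r₀
    μ≤r₀ = ≤-difference⇒≤ (0≤r (suc zero)) (drop zero)
    -- Discarding r₁ ≥ 0 from the charge leaves K itself, the source of `1#` in the conclusion.
    a₁-a₀≤K : a₁ - a₀ ≤ K
    a₁-a₀≤K = *-cancelʳ-≤ (<-≤-trans 0<μ μ≤r₀) (≤-of-difference
      (+-nonneg (difference-nonneg (charge zero)) (*-nonneg 0≤K (0≤r (suc zero))))
      (solve 5 (λ K r₀ r₁ a₀ a₁ → K :* r₀ :- (a₁ :- a₀) :* r₀ :=
          K :* (r₀ :- r₁) :- (a₁ :- a₀) :* r₀ :+ K :* r₁)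
        refl K r₀ r₁ a₀ a₁))
    a₁≤ : a₁ ≤ K * (x + 1#)
    a₁≤ = ≤-of-difference (+-nonneg (difference-nonneg a₁-a₀≤K) (difference-nonneg a≤))
      (solve 4 (λ K x a₀ a₁ → K :* (x :+ 𝟏) :- a₁ := K :- (a₁ :- a₀) :+ (K :* x :- a₀))
        refl K x a₀ a₁)
  logarithmic-cost {K} {μ} {R} {x} 0≤K 0<μ (suc k) a r 0≤r drop charge 0≤x a≤ bound =
    logarithmic-cost 0≤K 0<μ k (λ i → a (suc i)) (λ i → r (suc i)) (λ i → 0≤r (suc i))
      (λ i → drop (suc i)) (λ i → charge (suc i)) (+-nonneg 0≤x 0≤y) a₁≤
      -- The invariant passes to the next step: as r₁ = (1 - y) r₀, the factor lost by r pays for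
      -- the growth of the exponential from x to x + y.
      λ n → ≤-trans (≤-reflexive (trans (*-congˡ r₁≈)
          (solve 3 (λ e y r₀ → e :* ((𝟏 :- y) :* r₀) := e :* (𝟏 :- y) :* r₀) refl (expₙ n (x + y)) y r₀)))
        (≤-trans (*-monoˡ-≤ (0≤r zero) (expₙ-+-≤ 0≤x 0≤y n)) (bound n))
    where
    a₀ = a zero
    a₁ = a (suc zero)
    r₀ = r zero
    r₁ = r (suc zero)
    0≤r₀-r₁ : 0# ≤ r₀ - r₁
    0≤r₀-r₁ = ≤-trans (<⇒≤ 0<μ) (drop zero)
    0<r₀ : 0# < r₀
    0<r₀ = <-≤-trans 0<μ (≤-difference⇒≤ (0≤r (suc zero)) (drop zero))
    y = (r₀ - r₁) / r₀
    0≤y : 0# ≤ y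
    0≤y = /-nonneg 0≤r₀-r₁ 0<r₀
    y*r₀≈ : y * r₀ ≈ r₀ - r₁
    y*r₀≈ = /-cancel (r₀ - r₁) 0<r₀
    r₁≈ : r₁ ≈ (1# - y) * r₀
    r₁≈ = trans (solve 2 (λ r₀ r₁ → r₁ := r₀ :- (r₀ :- r₁)) refl r₀ r₁)
      (trans (+-congˡ (-‿cong (sym y*r₀≈))) (solve 2 (λ y r₀ → r₀ :- y :* r₀ := (𝟏 :- y) :* r₀) refl y r₀))
    a₁-a₀≤Ky : a₁ - a₀ ≤ K * y
    a₁-a₀≤Ky = *-cancelʳ-≤ 0<r₀ (≤-trans (charge zero) (≤-reflexive
      (trans (*-congˡ (sym y*r₀≈)) (solve 3 (λ K y r₀ → K :* (y :* r₀) := K :* y :* r₀) refl K y r₀))))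
    a₁≤ : a₁ ≤ K * (x + y)
    a₁≤ = ≤-of-difference (+-nonneg (difference-nonneg a₁-a₀≤Ky) (difference-nonneg a≤))
      (solve 5 (λ K x y a₀ a₁ → K :* (x :+ y) :- a₁ := K :* y :- (a₁ :- a₀) :+ (K :* x :- a₀))
        refl K x y a₀ a₁)

-- Submodular functions, truncation and approximation.

module SetFunctions {ℓ} (ℝ : Reals ℓ) where
  open Reals ℝ
  open RingIdentities ℝ
  open OrderedField ℝ
  open Exponential ℝ using (sum-mono-≤)
  open CommutativeRing commutativeRing
    using (refl; sym; trans; reflexive; +-assoc; +-comm; +-cong; +-congˡ; +-congʳ; -‿cong;
           +-identityˡ; +-identityʳ; semiring)
  open DecTotalOrder decTotalOrder
    using (total; totalOrder)
    renaming (refl to ≤-refl; trans to ≤-trans; reflexive to ≤-reflexive)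
  open Min totalOrder using (x⊓y≤x; x⊓y≤y; ⊓-glb; x≤y⇒x⊓y≈x; x≤y⇒y⊓x≈x)
  open Max totalOrder using (x≤x⊔y; x≤y⊔x)
  open SemiringSum semiring using (*-distribʳ-sum)

  -- Keeping `s` and `t` outside the sums lets cross-multiplied ratio comparisons be added up, as in
  -- `greedy-charge`.
  Σ-*-mono-≤ : ∀ {n} (X : Subset n) (g h : Fin n → Carrier) s t →
               (∀ x → g x * s ≤ h x * t) → (Σ[_]_ ℝ X g) * s ≤ (Σ[_]_ ℝ X h) * t
  Σ-*-mono-≤ {n} X g h s t g≤h = ≤-trans (≤-reflexive (*-distribʳ-sum s (restrict g)))
    (≤-trans (sum-mono-≤ (λ x → restrict g x * s) (λ x → restrict h x * t) restrict-≤)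
      (≤-reflexive (sym (*-distribʳ-sum t (restrict h)))))
    where
    restrict : (Fin n → Carrier) → Fin n → Carrier
    restrict w x = if lookup X x then w x else 0#
    restrict-≤ : ∀ x → restrict g x * s ≤ restrict h x * t
    restrict-≤ x with lookup X x
    ... | true  = g≤h x
    ... | false = ≤-reflexive (solve 2 (λ s t → 𝟎 :* s := 𝟎 :* t) refl s t)

  Σ-≤ : ∀ {n} (X : Subset n) (g : Fin n → Carrier) {b} → 0# ≤ b → (∀ x → g x ≤ b) →
        Σ[_]_ ℝ X g ≤ nat n * b
  Σ-≤ []          g {b} 0≤b g≤b = ≤-reflexive (solve 1 (λ b → 𝟎 := 𝟎 :* b) refl b)
  Σ-≤ {suc n} (s ∷ X) g {b} 0≤b g≤b = ≤-trans
    (+-mono-≤ (head-≤ s) (Σ-≤ X (λ x → g (suc x)) 0≤b (λ x → g≤b (suc x))))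
    (≤-reflexive (solve 2 (λ b n → b :+ n :* b := (𝟏 :+ n) :* b) refl b (nat n)))
    where
    head-≤ : ∀ s → (if s then g zero else 0#) ≤ b
    head-≤ true  = g≤b zero
    head-≤ false = 0≤b

  -- X is built up one element at a time: the leading bit is fixed inside `h` and the recursion runs
  -- over the remaining coordinates. A leading bit that is set costs one use of `step` at the empty
  -- set.
  union-bound : ∀ {n} (h : SetFunction ℝ n) (w : Fin n → Carrier) →
                (∀ X x → h (X ∪ ⁅ x ⁆) ≤ h X + w x) → ∀ X → h X ≤ h ⊥ + Σ[_]_ ℝ X w
  union-bound h w step [] = ≤-reflexive (sym (+-identityʳ (h [])))
  union-bound h w step (false ∷ X) = ≤-trans
    (union-bound (λ Y → h (false ∷ Y)) (λ x → w (suc x)) (λ Y x → step (false ∷ Y) (suc x)) X)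
    (≤-reflexive (+-congˡ (sym (+-identityˡ _))))
  union-bound h w step (true ∷ X) = ≤-trans
    (union-bound (λ Y → h (true ∷ Y)) (λ x → w (suc x)) (λ Y x → step (true ∷ Y) (suc x)) X)
    (≤-trans
      (+-mono-≤ (≡.subst (λ Y → h (true ∷ Y) ≤ h ⊥ + w zero) (∪-identityˡ ⊥) (step ⊥ zero)) ≤-refl)
      (≤-reflexive (+-assoc _ _ _)))

  ∪-absorb-⊆ : ∀ {n} {X : Subset n} {x} → x ∈ X → X ∪ ⁅ x ⁆ ⊆ X
  ∪-absorb-⊆ {X = X} {x} x∈X y∈ with x∈p∪q⁻ X ⁅ x ⁆ y∈
  ... | inj₁ y∈X = y∈X
  ... | inj₂ y∈x = ≡.subst (_∈ X) (≡.sym (x∈⁅y⁆⇒x≡y x y∈x)) x∈X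

  module _ {n} {g : SetFunction ℝ n} (mono : Monotone ℝ g) where

    Δ-nonneg : ∀ X x → 0# ≤ Δ ℝ g X x
    Δ-nonneg X x = difference-nonneg (mono X (X ∪ ⁅ x ⁆) (p⊆p∪q ⁅ x ⁆))

    Δ-nonpos : ∀ {X x} → x ∈ X → Δ ℝ g X x ≤ 0#
    Δ-nonpos {X} {x} x∈X = ≤-of-difference (difference-nonneg (mono (X ∪ ⁅ x ⁆) X (∪-absorb-⊆ x∈X)))
      (solve 2 (λ p q → 𝟎 :- (p :- q) := q :- p) refl (g (X ∪ ⁅ x ⁆)) (g X))

    truncate-monotone : ∀ τ → Monotone ℝ (truncate ℝ τ g)
    truncate-monotone τ X Y X⊆Y = ⊓-glb (x⊓y≤x τ (g X)) (≤-trans (x⊓y≤y τ (g X)) (mono X Y X⊆Y))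

    module _ (submod : Submodular ℝ g) where

      -- The elements of Y are added to X one by one. Submodularity bounds each gain by the gain at
      -- X; an element already present gains nothing, which monotonicity covers.
      marginal-bound : ∀ X Y → g (X ∪ Y) ≤ g X + Σ[_]_ ℝ Y (Δ ℝ g X)
      marginal-bound X Y = ≤-trans (union-bound (λ Z → g (X ∪ Z)) (Δ ℝ g X) step Y)
        (≤-reflexive (+-congʳ (reflexive (≡.cong g (∪-identityʳ X)))))
        where
        step : ∀ Z x → g (X ∪ (Z ∪ ⁅ x ⁆)) ≤ g (X ∪ Z) + Δ ℝ g X x
        step Z x = ≡.subst (λ W → g W ≤ g (X ∪ Z) + Δ ℝ g X x) (∪-assoc X Z ⁅ x ⁆)
          (≤-of-difference (difference-nonneg Δ≤)
            (solve 3 (λ p q d → q :+ d :- p := d :- (p :- q)) refl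
              (g ((X ∪ Z) ∪ ⁅ x ⁆)) (g (X ∪ Z)) (Δ ℝ g X x)))
          where
          Δ≤ : Δ ℝ g (X ∪ Z) x ≤ Δ ℝ g X x
          Δ≤ with x ∈? X ∪ Z
          ... | yes x∈ = ≤-trans (Δ-nonpos x∈) (Δ-nonneg X x)
          ... | no  x∉ = submod X (X ∪ Z) x (p⊆p∪q Z) x∉

      module _ (g⊥≈0 : g ⊥ ≈ 0#) where

        Δ-⊥ : ∀ x → Δ ℝ g ⊥ x ≈ g ⁅ x ⁆
        Δ-⊥ x = trans
          (+-cong (reflexive (≡.cong g (∪-identityˡ ⁅ x ⁆))) (-‿cong g⊥≈0))
          (solve 1 (λ p → p :- 𝟎 := p) refl (g ⁅ x ⁆))

        singleton-bound : ∀ X → g X ≤ Σ[_]_ ℝ X (λ x → g ⁅ x ⁆)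
        singleton-bound X = ≤-trans (union-bound g (λ x → g ⁅ x ⁆) step X)
          (≤-reflexive (trans (+-congʳ g⊥≈0) (+-identityˡ _)))
          where
          step : ∀ Y x → g (Y ∪ ⁅ x ⁆) ≤ g Y + g ⁅ x ⁆
          step Y x = ≤-of-difference (difference-nonneg Δ≤)
            (solve 3 (λ p q d → q :+ d :- p := d :- (p :- q)) refl (g (Y ∪ ⁅ x ⁆)) (g Y) (g ⁅ x ⁆))
            where
            Δ≤ : Δ ℝ g Y x ≤ g ⁅ x ⁆
            Δ≤ = ≤-trans (Δ-antitone Y x) (≤-reflexive (Δ-⊥ x))
              where
              Δ-antitone : ∀ Y x → Δ ℝ g Y x ≤ Δ ℝ g ⊥ x
              Δ-antitone Y x with x ∈? Y
              ... | yes x∈ = ≤-trans (Δ-nonpos x∈) (Δ-nonneg ⊥ x)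
              ... | no  x∉ = submod ⊥ Y x (⊥⊆ {p = Y}) x∉

      -- In the form of an inequality between sums of two values, three cases remain. If Y or X ∪ ⁅
      -- x ⁆ reaches τ, the truncated value there is the maximal one and monotonicity settles the
      -- other pair. Otherwise the right-hand side is untruncated and the submodularity of `g`
      -- applies.
      truncate-submodular : ∀ τ → Submodular ℝ (truncate ℝ τ g)
      truncate-submodular τ X Y x X⊆Y x∉Y = ≤-of-difference (difference-nonneg (cases (total τ p) (total τ q′)))
        (solve 4 (λ a b c d → a :- b :- (c :- d) := (a :+ d) :- (c :+ b)) refl
          (τ ⊓ g (X ∪ ⁅ x ⁆)) (τ ⊓ g X) (τ ⊓ g (Y ∪ ⁅ x ⁆)) (τ ⊓ g Y))
        where
        q = g X
        p = g Y
        q′ = g (X ∪ ⁅ x ⁆)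
        p′ = g (Y ∪ ⁅ x ⁆)
        cases : τ ≤ p ⊎ p ≤ τ → τ ≤ q′ ⊎ q′ ≤ τ → τ ⊓ p′ + τ ⊓ q ≤ τ ⊓ q′ + τ ⊓ p
        cases (inj₁ τ≤p) _ = ≤-trans
          (+-mono-≤ (≤-trans (x⊓y≤x τ p′) (≤-reflexive (sym (x≤y⇒x⊓y≈x τ≤p))))
            (truncate-monotone τ X (X ∪ ⁅ x ⁆) (p⊆p∪q ⁅ x ⁆)))
          (≤-reflexive (+-comm _ _))
        cases (inj₂ p≤τ) (inj₁ τ≤q′) = +-mono-≤
          (≤-trans (x⊓y≤x τ p′) (≤-reflexive (sym (x≤y⇒x⊓y≈x τ≤q′))))
          (truncate-monotone τ X Y X⊆Y)
        cases (inj₂ p≤τ) (inj₂ q′≤τ) = ≤-trans (+-mono-≤ (x⊓y≤y τ p′) (x⊓y≤y τ q)) (≤-trans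
          (≤-of-difference (difference-nonneg (submod X Y x X⊆Y x∉Y))
            (solve 4 (λ q p q′ p′ → q′ :+ p :- (p′ :+ q) := q′ :- q :- (p′ :- p)) refl q p q′ p′))
          (≤-reflexive (sym (+-cong (x≤y⇒y⊓x≈x q′≤τ) (x≤y⇒y⊓x≈x p≤τ)))))

  -- `τ ⊓ x - ε` lies below both τ and y; the comparison with τ is where 0 ≤ ε enters.
  ⊓-difference-≤ : ∀ {ε} → 0# ≤ ε → ∀ τ {x y} → x - y ≤ ε → τ ⊓ x - τ ⊓ y ≤ ε
  ⊓-difference-≤ {ε} 0≤ε τ {x} {y} x-y≤ε = ≤-of-difference (difference-nonneg shifted)
    (solve 3 (λ p q e → e :- (p :- q) := q :- (p :- e)) refl (τ ⊓ x) (τ ⊓ y) ε)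
    where
    shifted : τ ⊓ x - ε ≤ τ ⊓ y
    shifted = ⊓-glb
      (≤-of-difference (+-nonneg (difference-nonneg (x⊓y≤x τ x)) 0≤ε)
        (solve 3 (λ t p e → t :- (p :- e) := t :- p :+ e) refl τ (τ ⊓ x) ε))
      (≤-of-difference (+-nonneg (difference-nonneg (x⊓y≤y τ x)) (difference-nonneg x-y≤ε))
        (solve 4 (λ x y p e → y :- (p :- e) := x :- p :+ (e :- (x :- y))) refl x y (τ ⊓ x) ε))

  module _ {n ε} {F f : SetFunction ℝ n} (approx : Approximates ℝ ε F f) where

    f-F≤ε : ∀ X → f X - F X ≤ ε
    f-F≤ε X = ≤-trans (x≤x⊔y _ _) (approx X)

    F-f≤ε : ∀ X → F X - f X ≤ ε
    F-f≤ε X = ≤-trans (≤-reflexive (solve 2 (λ p q → q :- p := :- (p :- q)) refl (f X) (F X)))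
      (≤-trans (x≤y⊔x _ _) (approx X))

    module _ (0≤ε : 0# ≤ ε) (τ : Carrier) (X : Subset n) (x : Fin n) where
      private
        f₀ = τ ⊓ f X
        f₁ = τ ⊓ f (X ∪ ⁅ x ⁆)
        F₀ = τ ⊓ F X
        F₁ = τ ⊓ F (X ∪ ⁅ x ⁆)

      Δf≤ΔF+2ε : Δ ℝ (truncate ℝ τ f) X x ≤ Δ ℝ (truncate ℝ τ F) X x + (ε + ε)
      Δf≤ΔF+2ε = ≤-of-difference
        (+-nonneg (difference-nonneg (⊓-difference-≤ 0≤ε τ (f-F≤ε (X ∪ ⁅ x ⁆))))
          (difference-nonneg (⊓-difference-≤ 0≤ε τ (F-f≤ε X))))
        (solve 5 (λ f₀ f₁ F₀ F₁ ε → F₁ :- F₀ :+ (ε :+ ε) :- (f₁ :- f₀) := ε :- (f₁ :- F₁) :+ (ε :- (F₀ :- f₀)))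
          refl f₀ f₁ F₀ F₁ ε)

      ΔF≤Δf+2ε : Δ ℝ (truncate ℝ τ F) X x ≤ Δ ℝ (truncate ℝ τ f) X x + (ε + ε)
      ΔF≤Δf+2ε = ≤-of-difference
        (+-nonneg (difference-nonneg (⊓-difference-≤ 0≤ε τ (F-f≤ε (X ∪ ⁅ x ⁆))))
          (difference-nonneg (⊓-difference-≤ 0≤ε τ (f-F≤ε X))))
        (solve 5 (λ f₀ f₁ F₀ F₁ ε → f₁ :- f₀ :+ (ε :+ ε) :- (F₁ :- F₀) := ε :- (F₁ :- f₁) :+ (ε :- (f₀ :- F₀)))
          refl f₀ f₁ F₀ F₁ ε)

-- Analysis of the greedy algorithm.

module Greedy {ℓ} (ℝ : Reals ℓ) {n} (I : SCSC ℝ n) where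
  open Reals ℝ
  open SCSC I
  open RingIdentities ℝ
  open OrderedField ℝ
  open Exponential ℝ
  open SetFunctions ℝ
  open CommutativeRing commutativeRing
    using (setoid; refl; sym; *-comm; trans; reflexive; *-congˡ; *-congʳ; *-identityˡ)
  open DecTotalOrder decTotalOrder
    using (totalOrder)
    renaming (refl to ≤-refl; trans to ≤-trans; reflexive to ≤-reflexive)
  open Min totalOrder using (x⊓y≤x; ⊓-glb)

  c-pos : ∀ {X} → Nonempty X → 0# < c X
  c-pos {X} (x , x∈X) = c-nonnegative X , λ 0≈c →
    ∉⊥ (≡.subst (x ∈_) (Equivalence.to (c-zero X) (sym 0≈c)) x∈X)

  c⁅⁆-pos : ∀ x → 0# < c ⁅ x ⁆
  c⁅⁆-pos x = c-pos (x , x∈⁅x⁆ x)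

  c⊥≈0 : c ⊥ ≈ 0#
  c⊥≈0 = Equivalence.from (c-zero ⊥) ≡.refl

  c-increment : ∀ {X x} → x ∉ X → c (X ∪ ⁅ x ⁆) - c X ≤ c ⁅ x ⁆
  c-increment {X} {x} x∉X = ≤-trans (c-submodular ⊥ X x ⊥⊆ x∉X)
    (≤-reflexive (Δ-⊥ c-monotone c-submodular c⊥≈0 x))

  fτ : SetFunction ℝ n
  fτ = truncate ℝ τ f

  fτ-monotone : Monotone ℝ fτ
  fτ-monotone = truncate-monotone f-monotone τ

  cost : Fin n → Carrier
  cost x = c ⁅ x ⁆

  -- Monotonicity makes X ∪ Y feasible, so the truncated value there is τ, and `marginal-bound`
  -- estimates the distance to it.
  deficit-bound : ∀ {Y} → Feasible Y → ∀ X → τ - fτ X ≤ Σ[_]_ ℝ Y (Δ ℝ fτ X)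
  deficit-bound {Y} feasible X = ≤-of-difference
    (+-nonneg (difference-nonneg (marginal-bound fτ-monotone (truncate-submodular f-monotone f-submodular τ) X Y))
      (difference-nonneg (⊓-glb ≤-refl (≤-trans feasible (f-monotone Y (X ∪ Y) (q⊆p∪q X Y))))))
    (solve 4 (λ t p s q → s :- (t :- p) := p :+ s :- q :+ (q :- t)) refl
      τ (fτ X) (Σ[_]_ ℝ Y (Δ ℝ fτ X)) (fτ (X ∪ Y)))

  -- Curvature speaks of nonempty sets only, so this is what permits its use at A*.
  feasible⇒nonempty : 0# < τ → ∀ {X} → Feasible X → Nonempty X
  feasible⇒nonempty 0<τ {X} feasible with nonempty? X
  ... | yes X≢∅ = X≢∅
  ... | no  X≡∅ = contradiction
    (≤-trans feasible (≤-reflexive (trans (reflexive (≡.cong f (Empty-unique X≡∅))) f-empty)))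
    (<⇒≱ 0<τ)

  module _ {ρ} (curvature : IsCurvature ℝ c ρ) where

    curvature-bound : ∀ {X} → Nonempty X → Σ[_]_ ℝ X cost ≤ ρ * c X
    curvature-bound {X} X≢∅ = /≤⇒≤* (c-pos X≢∅) (proj₂ curvature X X≢∅)

    -- By subadditivity the singleton costs of a nonempty set add up to at least its cost; the set
    -- attaining the maximum provides an instance.
    1≤curvature : 1# ≤ ρ
    1≤curvature = let (X , X≢∅ , _) , _ = curvature in *-cancelʳ-≤ (c-pos X≢∅)
      (≤-trans (≤-reflexive (*-identityˡ (c X)))
        (≤-trans (singleton-bound c-monotone c-submodular c⊥≈0 X) (curvature-bound X≢∅)))

    0≤curvature : 0# ≤ ρ
    0≤curvature = ≤-trans (<⇒≤ 0<1) 1≤curvature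

  0<cmin : ∀ {cmin} → IsMin U cost cmin → 0# < cmin
  0<cmin ((x , _ , cx≈cmin) , _) = <-≤-trans (c⁅⁆-pos x) (≤-reflexive cx≈cmin)

  0≤cmax : ∀ {cmax} → IsMax U cost cmax → 0# ≤ cmax
  0≤cmax ((x , _ , cx≈cmax) , _) = ≤-trans (c-nonnegative ⁅ x ⁆) (≤-reflexive cx≈cmax)

  module _ {ε} (0≤ε : 0# ≤ ε) {cmin cmax} (ismin : IsMin U cost cmin) (ismax : IsMax U cost cmax) where

    private
      0<m = 0<cmin ismin
      0≤M = 0≤cmax ismax
      m≤ : ∀ x → cmin ≤ cost x
      m≤ x = proj₂ ismin x _
      ≤M : ∀ x → cost x ≤ cmax
      ≤M x = proj₂ ismax x _

    -- The error in comparing x with the greedy choice, per unit of the cost of x.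
    δ : Carrier
    δ = (nat 4 * ε * cmax) / cmin

    0≤δ : 0# ≤ δ
    0≤δ = /-nonneg (*-nonneg (*-nonneg (nat-nonneg 4) 0≤ε) 0≤M) 0<m

    -- Both c(u) and c(x) are at most cmax, hence at most (cmax / cmin) c(x); twice 2ε gives the
    -- constant 4.
    error-bound : ∀ x u → (ε + ε) * cost u + (ε + ε) * cost x ≤ δ * cost x
    error-bound x u = *-cancelʳ-≤ 0<m (≤-trans
      (≤-of-difference
        (*-nonneg (+-nonneg 0≤ε 0≤ε)
          (+-nonneg (*-nonneg (difference-nonneg (≤-trans (m≤ x) (≤M x))) (c-nonnegative _))
            (difference-nonneg (*-mono-≤ 0≤M (<⇒≤ 0<m) (≤M u) (m≤ x)))))
        (solve 5 (λ ε m M p q →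
            ((𝟏 :+ (𝟏 :+ (𝟏 :+ (𝟏 :+ 𝟎)))) :* ε :* M) :* q :- ((ε :+ ε) :* p :+ (ε :+ ε) :* q) :* m
          := (ε :+ ε) :* ((M :- m) :* q :+ (M :* q :- p :* m)))
          refl ε cmin cmax (cost u) (cost x)))
      (≤-reflexive (trans (*-congʳ (sym (/-cancel _ 0<m)))
        (solve 3 (λ d m q → d :* m :* q := d :* q :* m) refl δ cmin (cost x)))))

    module _ {F : SetFunction ℝ n} (approx : Approximates ℝ ε F f) {X u} (choice : GreedyChoice ℝ F c τ X u) where

      private
        d = Δ ℝ fτ X u

      -- For x outside X this is the greedy comparison of ratios, cross-multiplied, with the passage
      -- from f to F at x and back at u absorbed by `error-bound`. Elements of X, which the greedy
      -- rule does not rank, gain nothing while the right side is nonnegative; they matter because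
      -- A* may meet X.
      greedy-marginal : ∀ x → Δ ℝ fτ X x * cost u ≤ cost x * (d + δ)
      greedy-marginal x with x ∈? X
      ... | yes x∈X = ≤-trans
        (≤-trans (*-monoˡ-≤ (c-nonnegative _) (Δ-nonpos fτ-monotone x∈X))
          (≤-reflexive (solve 1 (λ p → 𝟎 :* p := 𝟎) refl (cost u))))
        (*-nonneg (c-nonnegative _) (+-nonneg (Δ-nonneg fτ-monotone X u) 0≤δ))
      ... | no  x∉X = ≤-of-difference
        (+-nonneg
          (+-nonneg (*-nonneg (difference-nonneg (Δf≤ΔF+2ε approx 0≤ε τ X x)) (c-nonnegative ⁅ u ⁆))
            (*-nonneg (difference-nonneg (ΔF≤Δf+2ε approx 0≤ε τ X u)) (c-nonnegative ⁅ x ⁆)))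
          (+-nonneg (difference-nonneg (/-cross (c⁅⁆-pos x) (c⁅⁆-pos u) (proj₂ choice x x∉X)))
            (difference-nonneg (error-bound x u))))
        (solve 8 (λ a b A B p q e δ → q :* (b :+ δ) :- a :* p :=
            (A :+ (e :+ e) :- a) :* p :+ (b :+ (e :+ e) :- B) :* q
              :+ ((B :* q :- A :* p) :+ (δ :* q :- ((e :+ e) :* p :+ (e :+ e) :* q))))
          refl (Δ ℝ fτ X x) d (Δ ℝ (truncate ℝ τ F) X x) (Δ ℝ (truncate ℝ τ F) X u) (cost u) (cost x) ε δ)

      greedy-charge : ∀ {Y} → Feasible Y → cost u * (τ - fτ X) ≤ (Σ[_]_ ℝ Y cost) * (d + δ)
      greedy-charge {Y} feasible = ≤-trans (*-monoʳ-≤ (c-nonnegative _) (deficit-bound feasible X))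
        (≤-trans (≤-reflexive (*-comm _ _))
          (Σ-*-mono-≤ Y (Δ ℝ fτ X) cost (cost u) (d + δ) greedy-marginal))

  τ≤n*α : ∀ {α} → IsMax U (λ x → f ⁅ x ⁆) α → τ ≤ nat n * α
  τ≤n*α ((x , _ , fx≈α) , fx≤α) = ≤-trans τ≤f[S]
    (≤-trans (singleton-bound f-monotone f-submodular f-empty ⊤)
      (Σ-≤ ⊤ (λ x → f ⁅ x ⁆) (≤-trans (f-nonnegative _) (≤-reflexive fx≈α)) (λ x → fx≤α x _)))

  greedy-feasible : ∀ {ε} → 0# ≤ ε → ∀ {F : SetFunction ℝ n} → Approximates ℝ ε F f →
                    ∀ {X} → τ ≤ F X → τ - ε ≤ f X
  greedy-feasible {ε} 0≤ε {F} approx {X} τ≤F = ≤-of-difference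
    (+-nonneg (difference-nonneg τ≤F) (difference-nonneg (F-f≤ε approx X)))
    (solve 4 (λ t e p q → p :- (t :- e) := q :- t :+ (e :- (q :- p))) refl τ ε (f X) (F X))

  -- The run has `suc k` iterations: the first one gives 0 < τ, and `logarithmic-cost` treats the
  -- last one separately.
  greedy-cost :
    ∀ {A*} → Feasible A* →
    ∀ {ε} → 0# ≤ ε →
    ∀ {F : SetFunction ℝ n} → Nonnegative ℝ F → Approximates ℝ ε F f →
    ∀ k (A : Fin (2 ℕ.+ k) → Subset n) → GreedyRun ℝ F c τ (suc k) A →
    ∀ {cmin cmax α ρ μ} →
    IsMin U cost cmin → IsMax U cost cmax → IsMax U (λ x → f ⁅ x ⁆) α → IsCurvature ℝ c ρ →
    (∀ i → μ ≤ fτ (A (suc i)) - fτ (A (inject₁ i))) → 0# < μ →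
    let κ = (nat 4 * ε * cmax * ρ) / (cmin * μ) in
    ∀ {γ} → 0# < γ → γ < 1# - κ →
    c (A (fromℕ (suc k))) ≤ ρ / (1# - κ - γ) * (ln ((nat n * α * ρ) / (γ * μ)) + nat 2) * c A*
  greedy-cost {A*} feasible {ε} 0≤ε {F} 0≤F approx k A run {cmin} {cmax} {α} {ρ} {μ}
              ismin ismax isα curvature μ≤ 0<μ {γ} 0<γ γ<1-κ = cost≤
    where
    open GreedyRun run
    κ = (nat 4 * ε * cmax * ρ) / (cmin * μ)
    0<m = 0<cmin ismin
    δ′ = δ 0≤ε ismin ismax
    0≤ρ = 0≤curvature curvature
    0≤c* = c-nonnegative A*

    0≤κ : 0# ≤ κ
    0≤κ = /-nonneg (*-nonneg (*-nonneg (*-nonneg (nat-nonneg 4) 0≤ε) (0≤cmax ismax)) 0≤ρ)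
      (*-pos 0<m 0<μ)

    κμ≈ρδ : κ * μ ≈ ρ * δ′
    κμ≈ρδ = begin
      κ * μ                                 ≈⟨ *-/-cancel (κ * μ) 0<m ⟨
      κ * μ * cmin / cmin                   ≈⟨ *-congʳ κμm≈ ⟩
      nat 4 * ε * cmax * ρ / cmin           ≈⟨ solve 3 (λ p r i → p :* r :* i := r :* (p :* i)) refl
                                               (nat 4 * ε * cmax) ρ (cmin ⁻¹) ⟩
      ρ * δ′                                ∎
      where
      open SetoidReasoning setoid
      κμm≈ : κ * μ * cmin ≈ nat 4 * ε * cmax * ρ
      κμm≈ = trans (solve 3 (λ k u m → k :* u :* m := k :* (m :* u)) refl κ μ cmin)
        (/-cancel _ (*-pos 0<m 0<μ))

    0<τ : 0# < τ
    -- The loop is entered, so τ exceeds a value of the nonnegative `F`.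
    0<τ = ≤-<-trans (0≤F _) (guard zero)

    K = c A* * (ρ + κ)
    0≤K : 0# ≤ K
    0≤K = *-nonneg 0≤c* (+-nonneg 0≤ρ 0≤κ)

    a r : Fin (2 ℕ.+ k) → Carrier
    a i = c (A i)
    r i = τ - fτ (A i)

    0≤r : ∀ i → 0# ≤ r i
    0≤r i = difference-nonneg (x⊓y≤x τ (f (A i)))

    r-drop : ∀ i → r (inject₁ i) - r (suc i) ≈ fτ (A (suc i)) - fτ (A (inject₁ i))
    r-drop i = solve 3 (λ t p q → t :- p :- (t :- q) := q :- p) refl τ (fτ (A (inject₁ i))) (fτ (A (suc i)))

    charge : ∀ i → (a (suc i) - a (inject₁ i)) * r (inject₁ i) ≤ K * (r (inject₁ i) - r (suc i))
    charge i with step i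
    ... | u , choice , next = ≤-trans
      (*-monoˡ-≤ (0≤r (inject₁ i))
        (≡.subst (λ Y → c Y - a (inject₁ i) ≤ cost u) (≡.sym next) (c-increment (proj₁ choice))))
      (≤-trans (greedy-charge 0≤ε ismin ismax approx choice feasible)
      (≤-trans (*-monoˡ-≤ (+-nonneg (Δ-nonneg fτ-monotone _ _) (0≤δ 0≤ε ismin ismax))
        (curvature-bound curvature (feasible⇒nonempty 0<τ feasible)))
      -- Here the additive error becomes a factor: ρδ = κμ ≤ κd turns ρ (d + δ) into at most (ρ + κ)
      -- d.
      (≤-trans (≤-of-difference
        (*-nonneg 0≤c* (difference-nonneg (≤-trans (≤-reflexive (sym κμ≈ρδ)) (*-monoʳ-≤ 0≤κ μ≤d))))
        (solve 5 (λ C ρ κ d δ → C :* (ρ :+ κ) :* d :- ρ :* C :* (d :+ δ) := C :* (κ :* d :- ρ :* δ))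
          refl (c A*) ρ κ d δ′))
      (≤-reflexive (*-congˡ (trans
        (≡.subst (λ Y → d ≈ fτ Y - fτ (A (inject₁ i))) (≡.sym next) refl) (sym (r-drop i))))))))
      where
      d = Δ ℝ fτ (A (inject₁ i)) u
      μ≤d : μ ≤ d
      μ≤d = ≡.subst (λ Y → μ ≤ fτ Y - fτ (A (inject₁ i))) next (μ≤ i)

    start-cost : a zero ≤ K * 0#
    start-cost = ≤-reflexive (trans (reflexive (≡.cong c start))
      (trans c⊥≈0 (solve 1 (λ K → 𝟎 := K :* 𝟎) refl K)))

    start-bound : ∀ n → expₙ n 0# * r zero ≤ r zero
    start-bound n = ≤-trans (*-monoˡ-≤ (0≤r zero) (expₙ-0 n)) (≤-reflexive (*-identityˡ _))

    r₀≤nα : r zero ≤ nat n * α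
    r₀≤nα = ≤-trans
      (≤-of-difference (⊓-glb (<⇒≤ 0<τ) (f-nonnegative (A zero)))
        (solve 2 (λ t p → t :- (t :- p) := p) refl τ (fτ (A zero))))
      (τ≤n*α isα)

    -- Together with 1 ≤ ρ this gives γ ≤ ρ, by which nα / μ is at most `Y`.
    γ≤1 : γ ≤ 1#
    γ≤1 = ≤-trans (<⇒≤ γ<1-κ) (≤-of-difference 0≤κ (solve 1 (λ k → 𝟏 :- (𝟏 :- k) := k) refl κ))

    Y = (nat n * α * ρ) / (γ * μ)
    D = 1# - κ - γ

    0<D : 0# < D
    0<D = ≰⇒> λ D≤0 → <⇒≱ γ<1-κ (≤-of-difference (difference-nonneg D≤0)
      (solve 2 (λ k g → g :- (𝟏 :- k) := 𝟎 :- (𝟏 :- k :- g)) refl κ γ))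

    -- After clearing `D`, the slack is κ (ρ - 1) + ργ + κ² + κγ, nonnegative because ρ ≥ 1.
    K≤ : K ≤ ρ / D * c A*
    K≤ = ≤-trans (≤-reflexive (*-comm _ _)) (*-monoˡ-≤ 0≤c* (*≤⇒≤/ 0<D
      (≤-of-difference
        (+-nonneg
          (+-nonneg (*-nonneg 0≤κ (difference-nonneg (1≤curvature curvature))) (*-nonneg 0≤ρ (<⇒≤ 0<γ)))
          (+-nonneg (*-nonneg 0≤κ 0≤κ) (*-nonneg 0≤κ (<⇒≤ 0<γ))))
        (solve 3 (λ ρ κ γ → ρ :- (ρ :+ κ) :* (𝟏 :- κ :- γ) := κ :* (ρ :- 𝟏) :+ ρ :* γ :+ (κ :* κ :+ κ :* γ))
          refl ρ κ γ))))

    cost≤ : a (fromℕ (suc k)) ≤ ρ / D * (ln Y + nat 2) * c A*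
    cost≤ = let y , 0≤y , a≤ , bound = logarithmic in ≤-trans a≤ (≤-trans
      (*-mono-≤ (*-nonneg (/-nonneg 0≤ρ 0<D) 0≤c*) (+-nonneg 0≤y (<⇒≤ 0<1)) K≤
        -- Of the constant 2, one unit pays for the last iteration and the other is spare.
        (+-mono-≤ (≤-ln 0≤y (bounded bound))
          (≤-of-difference (<⇒≤ 0<1) (solve 0 (𝟏 :+ (𝟏 :+ 𝟎) :- 𝟏 := 𝟏) refl))))
      (≤-reflexive (solve 3 (λ p c l → p :* c :* l := p :* l :* c) refl (ρ / D) (c A*) (ln Y + nat 2))))
      where
      logarithmic : ∃[ y ] 0# ≤ y × a (fromℕ (suc k)) ≤ K * (y + 1#) × (∀ n → expₙ n y * μ ≤ r zero)
      -- The exponent accumulates from x = 0, with `r zero` as the bound to be preserved.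
      logarithmic = logarithmic-cost 0≤K 0<μ k a r 0≤r
        (λ i → ≤-trans (μ≤ i) (≤-reflexive (sym (r-drop i)))) charge ≤-refl start-cost start-bound
      bounded : ∀ {y} → (∀ n → expₙ n y * μ ≤ r zero) → ExpBound y Y
      bounded {y} bound m = *≤⇒≤/ (*-pos 0<γ 0<μ) (≤-trans
        (≤-reflexive (solve 3 (λ e g u → e :* (g :* u) := (e :* u) :* g) refl (expₙ m y) γ μ))
        (*-mono-≤ 0≤nα (<⇒≤ 0<γ) (≤-trans (bound m) r₀≤nα) (≤-trans γ≤1 (1≤curvature curvature))))
        where
        0≤nα : 0# ≤ nat n * α
        0≤nα = ≤-trans (0≤r zero) r₀≤nα

theorem2 : ∀ {ℓ} (ℝ : Reals ℓ) → let open Reals ℝ in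
    ∀ (n : ℕ) .{{_ : NonZero n}} (I : SCSC ℝ n) → let open SCSC I in
    ∀ (A* : Subset n) → Optimal A* →
    ∀ (ε : Carrier) → 0# ≤ ε →
    ∀ (F : SetFunction ℝ n) → Nonnegative ℝ F → Approximates ℝ ε F f →
    ∀ (k : ℕ) (Aᵢ : Fin (suc k) → Subset n) → GreedyRun ℝ F c τ k Aᵢ →
    let A = Aᵢ (fromℕ k) in
    (τ - ε ≤ f A)
    ×
    (∀ (cmin cmax α ρ μ : Carrier) →
    IsMin U (λ x → c ⁅ x ⁆) cmin →
    IsMax U (λ x → c ⁅ x ⁆) cmax →
    IsMax U (λ x → f ⁅ x ⁆) α →
    IsCurvature ℝ c ρ →
    IsLeastIncrement ℝ f τ Aᵢ μ →
    (nat 4 * ε * cmax * ρ) / cmin < μ →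
    let κ = (nat 4 * ε * cmax * ρ) / (cmin * μ) in
    ∀ (γ : Carrier) → 0# < γ → γ < 1# - κ →
    c A ≤ ρ / (1# - κ - γ) * (ln ((nat n * α * ρ) / (γ * μ)) + nat 2) * c A*)
theorem2 ℝ n I A* (feasible , _) ε 0≤ε F 0≤F approx k Aᵢ run =
  greedy-feasible 0≤ε approx (GreedyRun.stop run) , cost-bound k Aᵢ run
  where
  open Reals ℝ
  open SCSC I
  open OrderedField ℝ
  open Greedy ℝ I
  cost-bound : ∀ k (Aᵢ : Fin (suc k) → Subset n) → GreedyRun ℝ F c τ k Aᵢ →
    ∀ cmin cmax α ρ μ → IsMin U cost cmin → IsMax U cost cmax → IsMax U (λ x → f ⁅ x ⁆) α →
    IsCurvature ℝ c ρ → IsLeastIncrement ℝ f τ Aᵢ μ →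
    (nat 4 * ε * cmax * ρ) / cmin < μ →
    let κ = (nat 4 * ε * cmax * ρ) / (cmin * μ) in
    ∀ γ → 0# < γ → γ < 1# - κ →
    c (Aᵢ (fromℕ k)) ≤ ρ / (1# - κ - γ) * (ln ((nat n * α * ρ) / (γ * μ)) + nat 2) * c A*
  -- A least increment would be attained at some index, and `Fin 0` has none.
  cost-bound zero    _  _   _    _    _ _ _ _     _     _  _         (() , _)
  cost-bound (suc k) Aᵢ run cmin cmax α ρ μ ismin ismax isα curvature (_ , μ≤) θ<μ γ 0<γ γ<1-κ =
    greedy-cost feasible 0≤ε 0≤F approx k Aᵢ run ismin ismax isα curvature (λ i → μ≤ i _) 0<μ 0<γ γ<1-κ
    where
    0<μ : 0# < μ
    -- The threshold that μ exceeds by assumption is itself nonnegative.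
    0<μ = ≤-<-trans
      (/-nonneg (*-nonneg (*-nonneg (*-nonneg (nat-nonneg 4) 0≤ε) (0≤cmax ismax))
        (0≤curvature curvature)) (0<cmin ismin))
      θ<μ
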